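{- For every intuitionistic formula $\varphi$ in $p_1,\dots,p_n$, every model $M$ and every $x\in M^s$, \[ M^s,x\models\varphi\iff M^s,x\models s(\varphi). \]
   Context: $F_{HA}(n)$ is the free Heyting algebra on $p_1,\dots,p_n$ (intuitionistic formulas modulo IPC-equivalence) and $F_{\wedge,\to}(n)$ the free implicative meet-semilattice on $p_1,\dots,p_n$ ($(\wedge,\to)$-formulas modulo IPC-equivalence). $F_{\wedge,\to}(n)$ is finite, hence a Heyting algebra with join $\varphi\veebar\psi=\bigwedge\{\chi\in F_{\wedge,\to}(n): \varphi\le\chi,\ \psi\le\chi\}$ and bottom $p_1\wedge\cdots\wedge p_n$. $s:F_{HA}(n)\to F_{\wedge,\to}(n)$ is the unique Heyting homomorphism with $s(p_i)=p_i$; concretely $s(\varphi)$ is obtained by replacing each $\vee$ by $\veebar$ and $\bot$ by $p_1\wedge\cdots\wedge p_n$; $s(\varphi)$ is taken to be any $(\wedge,\to)$-formula representing this class. Models are posets with an order-preserving colouring $c:M\to\{0,1\}^n$ (componentwise order) and intuitionistic Kripke semantics ($x\models p_i$ iff $c(x)_i=1$). A point $x$ is separated if for some variable $q$, $x\not\models q$ but all $y>x$ satisfy $q$. $M^s$ is the set of separated points with the restricted order and colouring, regarded as a model in its own right. -}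

module Defs where

open import Data.Bool.Base as Bool using (Bool; true)
open import Data.Empty.Polymorphic using (⊥)
open import Data.Fin.Base using (Fin; zero; suc)
open import Data.List.Base using (List; []; _∷_)
open import Data.List.Membership.Propositional using (_∈_)
open import Data.List.Relation.Binary.Subset.Propositional using (_⊆_)
open import Data.List.Relation.Binary.Subset.Propositional.Properties using (∷⁺ʳ; xs⊆x∷xs)
open import Data.List.Relation.Unary.Any using (here; there)
open import Data.Nat.Base using (ℕ; zero; suc)
open import Data.Product.Base using (∃; _×_; _,_; proj₁; proj₂)
open import Data.Sum.Base using (_⊎_)
open import Data.Unit.Polymorphic using (⊤)
open import Data.Vec.Functional using (Vector; foldr; tail)
open import Function.Base using (_∘_)
open import Level using (Level; Lift; _⊔_; 0ℓ) renaming (suc to lsuc)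
open import Relation.Binary.Bundles using (Poset)
open import Relation.Binary.PropositionalEquality using (_≡_; refl)
open import Relation.Nullary.Negation.Core using (¬_)
open import Relation.Unary using (Pred)
import Relation.Binary.Construct.On as On
import Relation.Binary.Properties.Poset as PosetProperties

infixr 7 _∧_
infixr 6 _∨_ _⊻_
infixr 5 _⇒_
infix  4 _⊢_ _≼_ _≋_

data Formula (n : ℕ) : Set where
  var         : Fin n → Formula n
  tt ff       : Formula n
  _∧_ _∨_ _⇒_ : (φ ψ : Formula n) → Formula n

-- The constant tt is the top element of an implicative meet-semilattice. For
-- n ≥ 1 it is definable as p ⇒ p; for n = 0 it is the empty conjunction.
data Formula∧⇒ (n : ℕ) : Set where
  var     : Fin n → Formula∧⇒ n
  tt      : Formula∧⇒ n
  _∧_ _⇒_ : (φ ψ : Formula∧⇒ n) → Formula∧⇒ n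

⌜_⌝ : ∀ {n} → Formula∧⇒ n → Formula n
⌜ var i ⌝ = var i
⌜ tt ⌝    = tt
⌜ φ ∧ ψ ⌝ = ⌜ φ ⌝ ∧ ⌜ ψ ⌝
⌜ φ ⇒ ψ ⌝ = ⌜ φ ⌝ ⇒ ⌜ ψ ⌝

-- Natural deduction for IPC.
data _⊢_ {n : ℕ} (Γ : List (Formula n)) : Formula n → Set where
  hyp : ∀ {φ} → φ ∈ Γ → Γ ⊢ φ
  ttI : Γ ⊢ tt
  ffE : ∀ {φ} → Γ ⊢ ff → Γ ⊢ φ
  ∧I  : ∀ {φ ψ} → Γ ⊢ φ → Γ ⊢ ψ → Γ ⊢ φ ∧ ψ
  ∧E₁ : ∀ {φ ψ} → Γ ⊢ φ ∧ ψ → Γ ⊢ φ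
  ∧E₂ : ∀ {φ ψ} → Γ ⊢ φ ∧ ψ → Γ ⊢ ψ
  ∨I₁ : ∀ {φ ψ} → Γ ⊢ φ → Γ ⊢ φ ∨ ψ
  ∨I₂ : ∀ {φ ψ} → Γ ⊢ ψ → Γ ⊢ φ ∨ ψ
  ∨E  : ∀ {φ ψ χ} → Γ ⊢ φ ∨ ψ → φ ∷ Γ ⊢ χ → ψ ∷ Γ ⊢ χ → Γ ⊢ χ
  ⇒I  : ∀ {φ ψ} → φ ∷ Γ ⊢ ψ → Γ ⊢ φ ⇒ ψ
  ⇒E  : ∀ {φ ψ} → Γ ⊢ φ ⇒ ψ → Γ ⊢ φ → Γ ⊢ ψ

weaken : ∀ {n} {Γ Δ : List (Formula n)} {φ} → Γ ⊆ Δ → Γ ⊢ φ → Δ ⊢ φ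
weaken ρ (hyp i)      = hyp (ρ i)
weaken ρ ttI          = ttI
weaken ρ (ffE d)      = ffE (weaken ρ d)
weaken ρ (∧I d e)     = ∧I (weaken ρ d) (weaken ρ e)
weaken ρ (∧E₁ d)      = ∧E₁ (weaken ρ d)
weaken ρ (∧E₂ d)      = ∧E₂ (weaken ρ d)
weaken ρ (∨I₁ d)      = ∨I₁ (weaken ρ d)
weaken ρ (∨I₂ d)      = ∨I₂ (weaken ρ d)
weaken ρ (∨E d e₁ e₂) = ∨E (weaken ρ d) (weaken (∷⁺ʳ _ ρ) e₁) (weaken (∷⁺ʳ _ ρ) e₂)
weaken ρ (⇒I d)       = ⇒I (weaken (∷⁺ʳ _ ρ) d)
weaken ρ (⇒E d e)     = ⇒E (weaken ρ d) (weaken ρ e)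

-- The free implicative meet-semilattice F∧⇒(n) is Formula∧⇒ n with order _≼_
-- and equality _≋_.
_≼_ : ∀ {n} → Formula∧⇒ n → Formula∧⇒ n → Set
φ ≼ ψ = ⌜ φ ⌝ ∷ [] ⊢ ⌜ ψ ⌝

_≋_ : ∀ {n} → Formula∧⇒ n → Formula∧⇒ n → Set
φ ≋ ψ = φ ≼ ψ × ψ ≼ φ

⋀ : ∀ {n k} → Vector (Formula∧⇒ n) k → Formula∧⇒ n
⋀ = foldr _∧_ tt

-- χ represents the meet, in F∧⇒(n), of the elements satisfying U.
record IsMeet {n : ℕ} (U : Pred (Formula∧⇒ n) 0ℓ) (χ : Formula∧⇒ n) : Set where
  field
    lowerBound : ∀ θ → U θ → χ ≼ θ
    greatest   : ∀ κ → (∀ θ → U θ → κ ≼ θ) → κ ≼ χ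

UpperBound : ∀ {n} → Formula∧⇒ n → Formula∧⇒ n → Pred (Formula∧⇒ n) 0ℓ
UpperBound φ ψ χ = φ ≼ χ × ψ ≼ χ

-- The meet of all common upper bounds exists: finiteness of F∧⇒(n) is not
-- needed, as ⋀ᵢ (((φ ⇒ pᵢ) ∧ (ψ ⇒ pᵢ)) ⇒ pᵢ) is always the least one.
⊻-exists : ∀ {n} (φ ψ : Formula∧⇒ n) → ∃ (IsMeet (UpperBound φ ψ))
⊻-exists {n} φ ψ = ⋀ clause , record
  { lowerBound = λ θ (φ≼θ , ψ≼θ) →
      least θ (weaken swap φ≼θ) (weaken swap ψ≼θ) (hyp (here refl))
  ; greatest   = λ κ κ≼ →
      κ≼ (⋀ clause)
         ( ⋀I clause (λ i → ⇒I (⇒E (∧E₁ (hyp (here refl))) (hyp (there (here refl)))))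
         , ⋀I clause (λ i → ⇒I (⇒E (∧E₂ (hyp (here refl))) (hyp (there (here refl))))))
  }
  where
  clause : Vector (Formula∧⇒ n) n
  clause i = ((φ ⇒ var i) ∧ (ψ ⇒ var i)) ⇒ var i

  ⋀I : ∀ {k Γ} (f : Vector (Formula∧⇒ n) k) → (∀ i → Γ ⊢ ⌜ f i ⌝) → Γ ⊢ ⌜ ⋀ f ⌝
  ⋀I {zero}  f d = ttI
  ⋀I {suc k} f d = ∧I (d zero) (⋀I (tail f) (d ∘ suc))

  ⋀E : ∀ {k Γ} (f : Vector (Formula∧⇒ n) k) → Γ ⊢ ⌜ ⋀ f ⌝ → ∀ i → Γ ⊢ ⌜ f i ⌝
  ⋀E f d zero    = ∧E₁ d
  ⋀E f d (suc i) = ⋀E (tail f) (∧E₂ d) i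

  swap : ∀ {α β : Formula n} → α ∷ [] ⊆ α ∷ β ∷ []
  swap (here e) = here e

  uncurry⇒ : ∀ {Γ} {α β γ : Formula n} → α ∷ Γ ⊢ β ⇒ γ → α ∷ β ∷ Γ ⊢ γ
  uncurry⇒ d = ⇒E (weaken (∷⁺ʳ _ (xs⊆x∷xs _ _)) d) (hyp (there (here refl)))

  least : ∀ {Γ} χ → ⌜ φ ⌝ ∷ Γ ⊢ ⌜ χ ⌝ → ⌜ ψ ⌝ ∷ Γ ⊢ ⌜ χ ⌝ →
          Γ ⊢ ⌜ ⋀ clause ⌝ → Γ ⊢ ⌜ χ ⌝
  least (var i)   d e j = ⇒E (⋀E clause j i) (∧I (⇒I d) (⇒I e))
  least tt        d e j = ttI
  least (χ₁ ∧ χ₂) d e j = ∧I (least χ₁ (∧E₁ d) (∧E₁ e) j) (least χ₂ (∧E₂ d) (∧E₂ e) j)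
  least (χ₁ ⇒ χ₂) d e j =
    ⇒I (least χ₂ (uncurry⇒ d) (uncurry⇒ e) (weaken (xs⊆x∷xs _ _) j))

_⊻_ : ∀ {n} → Formula∧⇒ n → Formula∧⇒ n → Formula∧⇒ n
φ ⊻ ψ = proj₁ (⊻-exists φ ψ)

s : ∀ {n} → Formula n → Formula∧⇒ n
s (var i) = var i
s tt      = tt
s ff      = ⋀ var
s (φ ∧ ψ) = s φ ∧ s ψ
s (φ ∨ ψ) = s φ ⊻ s ψ
s (φ ⇒ ψ) = s φ ⇒ s ψ

record Model (n : ℕ) (c ℓ₁ ℓ₂ : Level) : Set (lsuc (c ⊔ ℓ₁ ⊔ ℓ₂)) where
  field
    poset : Poset c ℓ₁ ℓ₂
  open Poset poset public using (Carrier; _≈_; _≤_)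
  open PosetProperties poset public using (_<_)
  field
    colour   : Carrier → Vector Bool n
    monotone : ∀ {x y} → x ≤ y → ∀ i → colour x i Bool.≤ colour y i

module _ {n : ℕ} {c ℓ₁ ℓ₂ : Level} where

  infix 3 _,_⊨_

  _,_⊨_ : (M : Model n c ℓ₁ ℓ₂) → Model.Carrier M → Formula n → Set (c ⊔ ℓ₂)
  M , x ⊨ var i = Lift (c ⊔ ℓ₂) (Model.colour M x i ≡ true)
  M , x ⊨ tt    = ⊤
  M , x ⊨ ff    = ⊥
  M , x ⊨ φ ∧ ψ = (M , x ⊨ φ) × (M , x ⊨ ψ)
  M , x ⊨ φ ∨ ψ = (M , x ⊨ φ) ⊎ (M , x ⊨ ψ)
  M , x ⊨ φ ⇒ ψ = ∀ y → Model._≤_ M x y → M , y ⊨ φ → M , y ⊨ ψ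

  Separated : (M : Model n c ℓ₁ ℓ₂) → Model.Carrier M → Set (c ⊔ ℓ₁ ⊔ ℓ₂)
  Separated M x =
    ∃ λ q → ¬ (M , x ⊨ var q) × (∀ y → Model._<_ M x y → M , y ⊨ var q)

  -- Points of M ˢ are compared by their underlying points in M, so the witness
  -- of separation does not affect the identity of a point.
  _ˢ : Model n c ℓ₁ ℓ₂ → Model n (c ⊔ ℓ₁ ⊔ ℓ₂) ℓ₁ ℓ₂
  M ˢ = record
    { poset    = On.poset (Model.poset M) (proj₁ {B = Separated M})
    ; colour   = Model.colour M ∘ proj₁
    ; monotone = Model.monotone M
    }

{-# OPTIONS --safe #-}
module Submission where

open import Axiom.ExcludedMiddle using (ExcludedMiddle)
open import Data.Bool.Base as Bool using (true; b≤b)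
open import Data.Bool.Properties using () renaming (_≟_ to _≟ᵇ_)
open import Data.Empty using (⊥-elim)
open import Data.Fin.Base using (zero; suc)
open import Data.List.Base using ([]; _∷_)
open import Data.List.Relation.Unary.All as All using (All; []; _∷_)
open import Data.List.Relation.Unary.Any using (here; there)
open import Data.Nat.Base using (ℕ)
open import Data.Product.Base using (_,_; proj₁; proj₂; map)
open import Data.Sum.Base as Sum using (inj₁; inj₂; [_,_]′)
open import Data.Vec.Functional using (Vector; tail)
open import Function.Base using (_∘_)
open import Function.Bundles using (_⇔_; mk⇔; module Equivalence)
open import Function.Construct.Composition using (_⇔-∘_)
open import Function.Construct.Identity using (⇔-id)
open import Level using (Level; _⊔_; lift; lower)
open import Relation.Binary.Bundles using (Poset)
open import Relation.Binary.PropositionalEquality using (_≡_; refl)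
open import Relation.Nullary using (¬_; yes; no)
open import Defs

-- At a point x of Mˢ, separated by q, every proper successor forces q. If x
-- refutes both φ and ψ, then x forces φ ⇒ q and ψ ⇒ q but not q, so it refutes
-- the upper bound ((φ ⇒ q) ∧ (ψ ⇒ q)) ⇒ q of φ and ψ. Hence ⊻ is read as ∨ on
-- Mˢ, and ⋀ᵢ pᵢ, which implies q, is read as ff.

true≤⇒true : ∀ {a b} → a Bool.≤ b → a ≡ true → b ≡ true
true≤⇒true b≤b refl = refl

module _ {n : ℕ} {c ℓ₁ ℓ₂ : Level} (M : Model n c ℓ₁ ℓ₂) where

  open Model M using (_≤_; monotone)
  open Poset (Model.poset M) using () renaming (refl to ≤-refl; trans to ≤-trans)

  persistent : ∀ φ {x y} → x ≤ y → M , x ⊨ φ → M , y ⊨ φ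
  persistent (var i) x≤y p       = lift (true≤⇒true (monotone x≤y i) (lower p))
  persistent tt      x≤y p       = p
  persistent (φ ∧ ψ) x≤y         = map (persistent φ x≤y) (persistent ψ x≤y)
  persistent (φ ∨ ψ) x≤y         = Sum.map (persistent φ x≤y) (persistent ψ x≤y)
  persistent (φ ⇒ ψ) x≤y f z y≤z = f z (≤-trans x≤y y≤z)

  -- The order `≼` is defined by derivability, so soundness is what carries inequalities of the free
  -- semilattice over to forcing in a model, in particular in `M ˢ`.
  sound : ∀ {Γ φ} → Γ ⊢ φ → ∀ {x} → All (M , x ⊨_) Γ → M , x ⊨ φ
  sound (hyp i)      γ = All.lookup γ i
  sound ttI          γ = _
  sound (ffE d)      γ with () ← sound d γ
  sound (∧I d e)     γ = sound d γ , sound e γ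
  sound (∧E₁ d)      γ = proj₁ (sound d γ)
  sound (∧E₂ d)      γ = proj₂ (sound d γ)
  sound (∨I₁ d)      γ = inj₁ (sound d γ)
  sound (∨I₂ d)      γ = inj₂ (sound d γ)
  sound (∨E d e₁ e₂) γ =
    [ (λ p → sound e₁ (p ∷ γ)) , (λ p → sound e₂ (p ∷ γ)) ]′ (sound d γ)
  sound (⇒I d)       γ y x≤y p =
    sound d (p ∷ All.map (λ {φ} → persistent φ x≤y) γ)
  sound (⇒E d e)     γ = sound d γ _ ≤-refl (sound e γ)

  ≼-sound : ∀ {σ τ : Formula∧⇒ n} → σ ≼ τ → ∀ {x} → M , x ⊨ ⌜ σ ⌝ → M , x ⊨ ⌜ τ ⌝
  ≼-sound d p = sound d (p ∷ [])

  ≋-sound : ∀ {σ τ : Formula∧⇒ n} → σ ≋ τ → ∀ {x} → (M , x ⊨ ⌜ σ ⌝) ⇔ (M , x ⊨ ⌜ τ ⌝)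
  ≋-sound {σ} {τ} (σ≼τ , τ≼σ) = mk⇔ (≼-sound {σ} {τ} σ≼τ) (≼-sound {τ} {σ} τ≼σ)

  ⊨-⋀⁻ : ∀ {k} (f : Vector (Formula∧⇒ n) k) {x} → M , x ⊨ ⌜ ⋀ f ⌝ → ∀ i → M , x ⊨ ⌜ f i ⌝
  ⊨-⋀⁻ f (p , _)  zero    = p
  ⊨-⋀⁻ f (_ , ps) (suc i) = ⊨-⋀⁻ (tail f) ps i

-- Since `σ` lies below every common upper bound of `σ` and `τ`, it lies below their meet.
≼-⊻ˡ : ∀ {n} (σ τ : Formula∧⇒ n) → σ ≼ σ ⊻ τ
≼-⊻ˡ σ τ = IsMeet.greatest (proj₂ (⊻-exists σ τ)) σ (λ _ → proj₁)

≼-⊻ʳ : ∀ {n} (σ τ : Formula∧⇒ n) → τ ≼ σ ⊻ τ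
≼-⊻ʳ σ τ = IsMeet.greatest (proj₂ (⊻-exists σ τ)) τ (λ _ → proj₂)

⊻-≼ : ∀ {n} (σ τ θ : Formula∧⇒ n) → σ ⊻ τ ≼ ((σ ⇒ θ) ∧ (τ ⇒ θ)) ⇒ θ
⊻-≼ σ τ θ = IsMeet.lowerBound (proj₂ (⊻-exists σ τ)) (((σ ⇒ θ) ∧ (τ ⇒ θ)) ⇒ θ)
  ( ⇒I (⇒E (∧E₁ (hyp (here refl))) (hyp (there (here refl))))
  , ⇒I (⇒E (∧E₂ (hyp (here refl))) (hyp (there (here refl)))) )

module _ {n : ℕ} {c ℓ₁ ℓ₂ : Level} (M : Model n c ℓ₁ ℓ₂) where

  open Poset (Model.poset M) using (module Eq) renaming (reflexive to ≤-reflexive)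

  -- A successor of `x` forcing `φ` cannot equal `x`, so it is proper and forces `q` by separation.
  -- The case split is on the Boolean colour of `y` at `q`, which avoids deciding whether `x` and
  -- `y` are equal.
  refuted-⇒-separator : (x@(_ , q , _) : Model.Carrier (M ˢ)) (φ : Formula n) →
                        ¬ (M ˢ , x ⊨ φ) → M ˢ , x ⊨ φ ⇒ var q
  refuted-⇒-separator x@(_ , q , _ , >⊨q) φ x⊭φ y@(y₀ , _) x≤y y⊨φ with Model.colour M y₀ q ≟ᵇ true
  ... | yes y⊨q = lift y⊨q
  ... | no  y⊭q = ⊥-elim (y⊭q (lower (>⊨q y₀ (x≤y , x≉y))))
    where
    x≉y : ¬ Model._≈_ M (proj₁ x) y₀
    x≉y x≈y = x⊭φ (persistent (M ˢ) φ (≤-reflexive (Eq.sym x≈y)) y⊨φ)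

  ⊨-⊻ : ExcludedMiddle (c ⊔ ℓ₁ ⊔ ℓ₂) → (x : Model.Carrier (M ˢ)) (σ τ : Formula∧⇒ n) →
        (M ˢ , x ⊨ ⌜ σ ⌝ ∨ ⌜ τ ⌝) ⇔ (M ˢ , x ⊨ ⌜ σ ⊻ τ ⌝)
  ⊨-⊻ em x@(_ , q , x⊭q , _) σ τ = mk⇔ to from
    where
    to : M ˢ , x ⊨ ⌜ σ ⌝ ∨ ⌜ τ ⌝ → M ˢ , x ⊨ ⌜ σ ⊻ τ ⌝
    to = [ ≼-sound (M ˢ) {σ} {σ ⊻ τ} (≼-⊻ˡ σ τ) , ≼-sound (M ˢ) {τ} {σ ⊻ τ} (≼-⊻ʳ σ τ) ]′

    from : M ˢ , x ⊨ ⌜ σ ⊻ τ ⌝ → M ˢ , x ⊨ ⌜ σ ⌝ ∨ ⌜ τ ⌝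
    -- Excluded middle yields a disjunct from the impossibility of refuting both.
    from p with em {M ˢ , x ⊨ ⌜ σ ⌝ ∨ ⌜ τ ⌝}
    ... | yes σ∨τ = σ∨τ
    -- `M ˢ` inherits its colouring from `M`, so forcing of `q` differs between the two models only
    -- in universe level.
    ... | no  x⊭   = ⊥-elim (x⊭q (lift (lower x⊨q)))
      where
      x⊨q : M ˢ , x ⊨ var q
      x⊨q = ≼-sound (M ˢ) {σ ⊻ τ} {((σ ⇒ var q) ∧ (τ ⇒ var q)) ⇒ var q} (⊻-≼ σ τ (var q))
              p x (≤-reflexive Eq.refl)
              ( refuted-⇒-separator x ⌜ σ ⌝ (x⊭ ∘ inj₁)
              , refuted-⇒-separator x ⌜ τ ⌝ (x⊭ ∘ inj₂) )

  ⊨-s : ExcludedMiddle (c ⊔ ℓ₁ ⊔ ℓ₂) → (φ : Formula n) (x : Model.Carrier (M ˢ)) →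
        (M ˢ , x ⊨ φ) ⇔ (M ˢ , x ⊨ ⌜ s φ ⌝)
  ⊨-s em = go
    where
    open Equivalence

    go : (φ : Formula n) (x : Model.Carrier (M ˢ)) → (M ˢ , x ⊨ φ) ⇔ (M ˢ , x ⊨ ⌜ s φ ⌝)
    go (var i) x = ⇔-id _
    go tt      x = ⇔-id _
    go ff      x@(_ , q , x⊭q , _) =
      mk⇔ (λ ()) (λ p → ⊥-elim (x⊭q (lift (lower (⊨-⋀⁻ (M ˢ) var p q)))))
    go (φ ∧ ψ) x = mk⇔ (map (to (go φ x)) (to (go ψ x))) (map (from (go φ x)) (from (go ψ x)))
    go (φ ∨ ψ) x =
      ⊨-⊻ em x (s φ) (s ψ)
      ⇔-∘ mk⇔ (Sum.map (to (go φ x)) (to (go ψ x))) (Sum.map (from (go φ x)) (from (go ψ x)))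
    -- The successors quantified over are points of `M ˢ`, hence separated themselves, so the
    -- induction hypotheses apply at each of them.
    go (φ ⇒ ψ) x =
      mk⇔ (λ f y x≤y → to (go ψ y) ∘ f y x≤y ∘ from (go φ y))
          (λ f y x≤y → from (go ψ y) ∘ f y x≤y ∘ to (go φ y))

theorem3p18 : {c ℓ₁ ℓ₂ : Level} → ExcludedMiddle (c ⊔ ℓ₁ ⊔ ℓ₂) →
    (n : ℕ) (φ : Formula n) (σ : Formula∧⇒ n) → σ ≋ s φ →
    (M : Model n c ℓ₁ ℓ₂) (x : Model.Carrier (M ˢ)) →
    (M ˢ , x ⊨ φ) ⇔ (M ˢ , x ⊨ ⌜ σ ⌝)
-- Soundness passes from the specific formula `s φ` to an arbitrary representative `σ` of its class.
theorem3p18 em n φ σ (σ≼sφ , sφ≼σ) M x = ≋-sound (M ˢ) {s φ} {σ} (sφ≼σ , σ≼sφ) ⇔-∘ ⊨-s M em φ x
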